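{- Let $F$ be a formula over $L$, let $E$ be an $\mathcal{E}$-formula over $L$, and let $\sigma$ be a (finite) substitution that corresponds to $E$ (in the sense of the context). Then $\mathrm{FEA}(L)\models F\sigma$ iff $\mathrm{FEA}(L)\models E\rightarrow F$; equivalently, $\mathrm{FEA}(L)\models (\forall)F\sigma\leftrightarrow(\forall)(E\rightarrow F)$.
   Context: $L$ is a first-order language with equality whose function symbols include at least one constant; the variables form a fixed enumerated denumerable set $\mathit{Var}$. $(\forall)G$ denotes the universal closure of $G$; $\mathrm{vars}(G)$ is the set of free variables of $G$; $G_x[t]$ denotes replacement of the free occurrences of $x$ in $G$ by $t$. $\mathrm{FEA}(L)$ (free equality axioms): $f(\bar x)=f(\bar y)\leftrightarrow x_1=y_1\wedge\dots\wedge x_n=y_n$ for each $n$-ary $f$; $f(\bar x)=g(\bar y)\leftrightarrow\mathit{False}$ for distinct $f,g$; $x=t\leftrightarrow\mathit{False}$ whenever $x\not\equiv t$ and $x$ occurs in $t$. An $\mathcal{E}$-formula is built from $\mathit{True}$, $\mathit{False}$ and equations using $\wedge,\exists$; $E\approx E'$ iff $\mathrm{FEA}(L)\models E\leftrightarrow E'$. An $\mathcal{E}$-formula is in solved form if it is $\mathit{True}$, $\mathit{False}$, or $(\exists z_1)\dots(\exists z_m)(x_1=s_1\wedge\dots\wedge x_n=s_n)$ with the $x_i,z_j$ pairwise distinct variables, no $x_i$ occurring in any $s_j$, each $z_j$ occurring in the conjunction, and $z_j\not\equiv s_i$; its parameters are its free variables other than $x_1,\dots,x_n$. Substitutions: a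 finite substitution $\sigma=\{x_1/s_1,\dots,x_n/s_n\}$ maps a finite set $\mathrm{Dom}(\sigma)$ of variables to terms; $\mathrm{Range}(\sigma)$ is the set of variables occurring in the $s_i$; $t\sigma$ is simultaneous replacement; $\sigma\tau$ is composition, $(\sigma\tau)(x)=\sigma(x)\tau$ (defined when $\mathrm{Range}(\sigma)\subseteq\mathrm{Dom}(\tau)$); $\sigma|_X$ is the restriction to $\mathrm{Dom}(\sigma)\cap X$; $\theta$ is a regular extension of $\sigma$ if it extends $\sigma$ and maps $\mathrm{Dom}(\theta)\setminus\mathrm{Dom}(\sigma)$ injectively into variables not in $\mathrm{Range}(\sigma)$. $\sigma\preceq\theta$ iff $\sigma'=\theta'\tau$ for some $\tau$ and some regular extensions $\sigma',\theta'$ of $\sigma,\theta$ with equal domains; $\sigma\approx\theta$ iff both $\sigma\preceq\theta$ and $\theta\preceq\sigma$. Correspondence: $\sigma$ corresponds to $E$ if either $E\approx\mathit{True}$ and $\sigma\approx\emptyset$ (the empty substitution), or $E\approx E'$ for some $\mathcal{E}$-formula $E'\equiv(\exists z_1)\dots(\exists z_m)(x_1=s_1\wedge\dots\wedge x_n=s_n)$ in solved form and $\sigma\approx\{x_1/s_1,\dots,x_n/s_n,y_1/y_1,\dots,y_k/y_k\}$, where $y_1,\dots,y_k$ are the parameters of $E'$. Application $F\sigma$ of a substitution to a formula: first, if $\mathrm{Dom}(\sigma)=\mathrm{vars}(F)$, define by structural induction: for an atom or equation, apply $\sigma$ to all argument terms; $(\neg G)\sigma=\neg(G\sigma)$; $(G\,b\,H)\sigma=G\sigma_1\,b\,H\sigma_2$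 for $b\in\{\wedge,\vee,\to,\leftrightarrow\}$ with $\sigma_1=\sigma|_{\mathrm{vars}(G)}$, $\sigma_2=\sigma|_{\mathrm{vars}(H)}$; for $F=(\exists x)G$: if $x\notin\mathrm{Range}(\sigma)$, $F\sigma=(\exists x)(G\sigma')$ where $\sigma'=\sigma\cup\{x/x\}$ if $x\in\mathrm{vars}(G)$ and $\sigma'=\sigma$ otherwise; if $x\in\mathrm{Range}(\sigma)$, let $y$ be the first variable of $\mathit{Var}$ not in $\mathrm{Range}(\sigma)$ and $F\sigma=(\exists y)(G_x[y]\sigma')$ where $\sigma'=\sigma\cup\{y/y\}$ if $x\in\mathrm{vars}(G)$ and $\sigma'=\sigma$ otherwise; $(\forall x)G$ is handled analogously. For arbitrary $\sigma$: let $\sigma'=\sigma|_{\mathrm{vars}(F)}$ and build $\sigma''$ from $\sigma'$ by repeatedly taking the first variable $x$ of $\mathrm{vars}(F)\setminus\mathrm{Dom}(\sigma'')$ and adding $x/y$, where $y=x$ if $x\notin\mathrm{Range}(\sigma'')$ and otherwise $y$ is the first variable not in $\mathrm{Range}(\sigma'')$; then $F\sigma:=F\sigma''$.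
   Formalization: When x is in Range(σ), the new bound variable y is the first variable neither in Range(σ) nor occurring in the quantified formula, since the literal choice can capture variables and falsify the claim; only the first "iff" is stated, not the equivalent form with universal closures. -}

module Defs where

open import Level using (0ℓ)
open import Data.Nat using (ℕ; zero; suc; _+_; _⊓_; _≡ᵇ_)
open import Data.Nat.Properties using (_≟_)
open import Data.Fin using (Fin; toℕ)
open import Data.Bool using (Bool; true; false; if_then_else_)
open import Data.List using (List; []; _∷_; _++_; filter; length; foldr; map; concatMap)
open import Data.List.Membership.Propositional using (_∈_; _∉_)
open import Data.List.Membership.DecPropositional _≟_ using (_∈?_)
open import Data.List.Relation.Unary.Unique.Propositional using (Unique)
open import Data.Vec using (Vec; []; _∷_; tabulate)
open import Data.Product using (Σ; _×_; _,_; proj₁; proj₂)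
open import Data.Sum using (_⊎_)
open import Data.Empty using (⊥)
open import Data.Unit using (⊤)
open import Relation.Nullary using (¬_; does; ¬?)
open import Relation.Binary.PropositionalEquality using (_≡_)
open import Function.Bundles using (_⇔_)
open import Axiom.ExcludedMiddle using (ExcludedMiddle)

Classical : Set₁
Classical = ExcludedMiddle 0ℓ

-- Variables: the fixed enumerated denumerable set Var is ℕ
-- (its enumeration order is the usual order on ℕ).
Var : Set
Var = ℕ

record Lang : Set₁ where
  field
    Fsym     : Set
    farity   : Fsym → ℕ
    Psym     : Set
    parity   : Psym → ℕ
    constant : Σ Fsym (λ c → farity c ≡ 0)

minList : ℕ → List ℕ → ℕ
minList v rest = foldr _⊓_ v rest

fresh : List Var → Var
fresh l = go (length l) 0
  where
  go : ℕ → ℕ → ℕ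
  go zero k = k
  go (suc n) k = if does (k ∈? l) then go n (suc k) else k

module _ (L : Lang) where
  open Lang L

  data Term : Set where
    var : Var → Term
    fn  : (f : Fsym) → Vec Term (farity f) → Term

  infixr 6 _∧'_
  infixr 5 _∨'_
  infixr 4 _⇒'_ _⇔'_
  infix  7 _≐_

  data Formula : Set where
    tt ff : Formula
    atom  : (p : Psym) → Vec Term (parity p) → Formula
    _≐_   : Term → Term → Formula
    ¬'_   : Formula → Formula
    _∧'_ _∨'_ _⇒'_ _⇔'_ : Formula → Formula → Formula
    ∃' ∀' : Var → Formula → Formula

  mutual
    tvars : Term → List Var
    tvars (var x) = x ∷ []
    tvars (fn f ts) = tvars* ts

    tvars* : ∀ {n} → Vec Term n → List Var
    tvars* [] = []
    tvars* (t ∷ ts) = tvars t ++ tvars* ts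

  remove : Var → List Var → List Var
  remove x = filter (λ v → ¬? (v ≟ x))

  fv : Formula → List Var
  fv tt = []
  fv ff = []
  fv (atom p ts) = tvars* ts
  fv (s ≐ t) = tvars s ++ tvars t
  fv (¬' G) = fv G
  fv (G ∧' H) = fv G ++ fv H
  fv (G ∨' H) = fv G ++ fv H
  fv (G ⇒' H) = fv G ++ fv H
  fv (G ⇔' H) = fv G ++ fv H
  fv (∃' x G) = remove x (fv G)
  fv (∀' x G) = remove x (fv G)

  allVars : Formula → List Var
  allVars tt = []
  allVars ff = []
  allVars (atom p ts) = tvars* ts
  allVars (s ≐ t) = tvars s ++ tvars t
  allVars (¬' G) = allVars G
  allVars (G ∧' H) = allVars G ++ allVars H
  allVars (G ∨' H) = allVars G ++ allVars H
  allVars (G ⇒' H) = allVars G ++ allVars H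
  allVars (G ⇔' H) = allVars G ++ allVars H
  allVars (∃' x G) = x ∷ allVars G
  allVars (∀' x G) = x ∷ allVars G

  size : Formula → ℕ
  size (¬' G) = suc (size G)
  size (G ∧' H) = suc (size G + size H)
  size (G ∨' H) = suc (size G + size H)
  size (G ⇒' H) = suc (size G + size H)
  size (G ⇔' H) = suc (size G + size H)
  size (∃' x G) = suc (size G)
  size (∀' x G) = suc (size G)
  size _ = 1

  mutual
    renT : Var → Var → Term → Term
    renT x y (var v) = if v ≡ᵇ x then var y else var v
    renT x y (fn f ts) = fn f (renT* x y ts)

    renT* : ∀ {n} → Var → Var → Vec Term n → Vec Term n
    renT* x y [] = []
    renT* x y (t ∷ ts) = renT x y t ∷ renT* x y ts

  ren : Var → Var → Formula → Formula
  ren x y tt = tt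
  ren x y ff = ff
  ren x y (atom p ts) = atom p (renT* x y ts)
  ren x y (s ≐ t) = renT x y s ≐ renT x y t
  ren x y (¬' G) = ¬' ren x y G
  ren x y (G ∧' H) = ren x y G ∧' ren x y H
  ren x y (G ∨' H) = ren x y G ∨' ren x y H
  ren x y (G ⇒' H) = ren x y G ⇒' ren x y H
  ren x y (G ⇔' H) = ren x y G ⇔' ren x y H
  ren x y (∃' z G) = if z ≡ᵇ x then ∃' z G else ∃' z (ren x y G)
  ren x y (∀' z G) = if z ≡ᵇ x then ∀' z G else ∀' z (ren x y G)

  -- Finite substitutions: a finite domain (list read as a set) and
  -- the values on it (values outside dom are irrelevant).
  record Subst : Set where
    constructor mkSubst
    field
      dom : List Var
      val : Var → Term
  open Subst public

  mutual
    subT : Subst → Term → Term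
    subT σ (var x) = val σ x
    subT σ (fn f ts) = fn f (subT* σ ts)

    subT* : ∀ {n} → Subst → Vec Term n → Vec Term n
    subT* σ [] = []
    subT* σ (t ∷ ts) = subT σ t ∷ subT* σ ts

  Range : Subst → List Var
  Range σ = concatMap (λ x → tvars (val σ x)) (dom σ)

  emptySubst : Subst
  emptySubst = mkSubst [] var

  restrict : Subst → List Var → Subst
  restrict σ X = mkSubst (filter (λ v → v ∈? X) (dom σ)) (val σ)

  add : Subst → Var → Term → Subst
  add σ x t = mkSubst (x ∷ dom σ) (λ v → if v ≡ᵇ x then t else val σ v)

  comp : Subst → Subst → Subst
  comp σ τ = mkSubst (dom σ) (λ x → subT τ (val σ x))

  SameDom : Subst → Subst → Set
  SameDom σ τ = (∀ v → v ∈ dom σ → v ∈ dom τ) × (∀ v → v ∈ dom τ → v ∈ dom σ)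

  SubstEq : Subst → Subst → Set
  SubstEq σ τ = SameDom σ τ × (∀ v → v ∈ dom σ → val σ v ≡ val τ v)

  RegExt : Subst → Subst → Set
  RegExt θ σ =
    (∀ v → v ∈ dom σ → v ∈ dom θ) ×
    (∀ v → v ∈ dom σ → val θ v ≡ val σ v) ×
    (∀ v → v ∈ dom θ → v ∉ dom σ → Σ Var (λ w → (val θ v ≡ var w) × (w ∉ Range σ))) ×
    (∀ v w → v ∈ dom θ → v ∉ dom σ → w ∈ dom θ → w ∉ dom σ → val θ v ≡ val θ w → v ≡ w)

  _⪯_ : Subst → Subst → Set
  σ ⪯ θ = Σ Subst (λ τ → Σ Subst (λ σ' → Σ Subst (λ θ' →
            RegExt σ' σ × RegExt θ' θ × SameDom σ' θ' ×
            (∀ v → v ∈ Range θ' → v ∈ dom τ) ×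
            SubstEq σ' (comp θ' τ))))

  _≈ₛ_ : Subst → Subst → Set
  σ ≈ₛ θ = (σ ⪯ θ) × (θ ⪯ σ)

  -- Application F σ of a substitution to a formula.
  -- applyD: the case Dom(σ) = vars(F); the first argument is fuel
  -- (size F suffices; renaming preserves size).
  applyD : ℕ → Formula → Subst → Formula
  applyD zero F σ = F
  applyD (suc n) tt σ = tt
  applyD (suc n) ff σ = ff
  applyD (suc n) (atom p ts) σ = atom p (subT* σ ts)
  applyD (suc n) (s ≐ t) σ = subT σ s ≐ subT σ t
  applyD (suc n) (¬' G) σ = ¬' applyD n G σ
  applyD (suc n) (G ∧' H) σ = applyD n G (restrict σ (fv G)) ∧' applyD n H (restrict σ (fv H))
  applyD (suc n) (G ∨' H) σ = applyD n G (restrict σ (fv G)) ∨' applyD n H (restrict σ (fv H))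
  applyD (suc n) (G ⇒' H) σ = applyD n G (restrict σ (fv G)) ⇒' applyD n H (restrict σ (fv H))
  applyD (suc n) (G ⇔' H) σ = applyD n G (restrict σ (fv G)) ⇔' applyD n H (restrict σ (fv H))
  applyD (suc n) (∃' x G) σ =
    if does (x ∈? Range σ)
    then (let y = fresh (Range σ ++ allVars (∃' x G)) in
          ∃' y (applyD n (ren x y G) (if does (x ∈? fv G) then add σ y (var y) else σ)))
    else ∃' x (applyD n G (if does (x ∈? fv G) then add σ x (var x) else σ))
  applyD (suc n) (∀' x G) σ =
    if does (x ∈? Range σ)
    then (let y = fresh (Range σ ++ allVars (∀' x G)) in
          ∀' y (applyD n (ren x y G) (if does (x ∈? fv G) then add σ y (var y) else σ)))
    else ∀' x (applyD n G (if does (x ∈? fv G) then add σ x (var x) else σ))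

  extendStep : ℕ → List Var → Subst → Subst
  extendStep zero vs σ = σ
  extendStep (suc n) vs σ = pick (filter (λ v → ¬? (v ∈? dom σ)) vs)
    where
    pick : List Var → Subst
    pick [] = σ
    pick (v ∷ rest) =
      let x = minList v rest
          y = if does (x ∈? Range σ) then fresh (Range σ) else x
      in extendStep n vs (add σ x (var y))

  _·_ : Formula → Subst → Formula
  F · σ = applyD (size F) F (extendStep (length (fv F)) (fv F) (restrict σ (fv F)))

  record Structure : Set₁ where
    field
      Carrier : Set
      funI    : (f : Fsym) → Vec Carrier (farity f) → Carrier
      relI    : (p : Psym) → Vec Carrier (parity p) → Set
  open Structure public

  module _ (M : Structure) where
    mutual
      evalT : (Var → Carrier M) → Term → Carrier M
      evalT ρ (var x) = ρ x
      evalT ρ (fn f ts) = funI M f (evalT* ρ ts)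

      evalT* : ∀ {n} → (Var → Carrier M) → Vec Term n → Vec (Carrier M) n
      evalT* ρ [] = []
      evalT* ρ (t ∷ ts) = evalT ρ t ∷ evalT* ρ ts

    update : (Var → Carrier M) → Var → Carrier M → (Var → Carrier M)
    update ρ x a v = if v ≡ᵇ x then a else ρ v

    Sat : (Var → Carrier M) → Formula → Set
    Sat ρ tt = ⊤
    Sat ρ ff = ⊥
    Sat ρ (atom p ts) = relI M p (evalT* ρ ts)
    Sat ρ (s ≐ t) = evalT ρ s ≡ evalT ρ t
    Sat ρ (¬' G) = ¬ Sat ρ G
    Sat ρ (G ∧' H) = Sat ρ G × Sat ρ H
    Sat ρ (G ∨' H) = Sat ρ G ⊎ Sat ρ H
    Sat ρ (G ⇒' H) = Sat ρ G → Sat ρ H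
    Sat ρ (G ⇔' H) = (Sat ρ G → Sat ρ H) × (Sat ρ H → Sat ρ G)
    Sat ρ (∃' x G) = Σ (Carrier M) (λ a → Sat (update ρ x a) G)
    Sat ρ (∀' x G) = (a : Carrier M) → Sat (update ρ x a) G

  conjF : List Formula → Formula
  conjF [] = tt
  conjF (φ ∷ []) = φ
  conjF (φ ∷ ψ ∷ φs) = φ ∧' conjF (ψ ∷ φs)

  varsFrom : (k n : ℕ) → Vec Term n
  varsFrom k n = tabulate (λ (i : Fin n) → var (k + toℕ i))

  eqsPair : ∀ {n} → Vec Term n → Vec Term n → List Formula
  eqsPair [] [] = []
  eqsPair (s ∷ ss) (t ∷ ts) = (s ≐ t) ∷ eqsPair ss ts

  data FEAAxiom : Formula → Set where
    decomp : (f : Fsym) →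
      FEAAxiom ((fn f (varsFrom 0 (farity f)) ≐ fn f (varsFrom (farity f) (farity f)))
                ⇔' conjF (eqsPair (varsFrom 0 (farity f)) (varsFrom (farity f) (farity f))))
    clash : (f g : Fsym) → ¬ (f ≡ g) →
      FEAAxiom ((fn f (varsFrom 0 (farity f)) ≐ fn g (varsFrom (farity f) (farity g))) ⇔' ff)
    occurs : (x : Var) (t : Term) → ¬ (t ≡ var x) → x ∈ tvars t →
      FEAAxiom ((var x ≐ t) ⇔' ff)

  -- M is a model of FEA(L) (axioms read as their universal closures)
  IsFEAModel : Structure → Set
  IsFEAModel M = ∀ φ → FEAAxiom φ → ∀ ρ → Sat M ρ φ

  -- FEA(L) ⊨ φ (φ read as its universal closure)
  FEA⊨ : Formula → Set₁
  FEA⊨ φ = (M : Structure) → IsFEAModel M → ∀ ρ → Sat M ρ φ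

  data IsE : Formula → Set where
    eTrue  : IsE tt
    eFalse : IsE ff
    eEq    : ∀ s t → IsE (s ≐ t)
    eAnd   : ∀ {G H} → IsE G → IsE H → IsE (G ∧' H)
    eEx    : ∀ {G} x → IsE G → IsE (∃' x G)

  _≈E_ : Formula → Formula → Set₁
  E ≈E E' = FEA⊨ (E ⇔' E')

  exs : List Var → Formula → Formula
  exs [] φ = φ
  exs (z ∷ zs) φ = ∃' z (exs zs φ)

  record SolvedData : Set where
    constructor solved
    field
      zs   : List Var
      eq₀  : Var × Term
      eqs  : List (Var × Term)

    allEqs : List (Var × Term)
    allEqs = eq₀ ∷ eqs

    xs : List Var
    xs = map proj₁ allEqs

    ss : List Term
    ss = map proj₂ allEqs

    matrix : Formula
    matrix = conjF (map (λ p → var (proj₁ p) ≐ proj₂ p) allEqs)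

    formula : Formula
    formula = exs zs matrix

    params : List Var
    params = filter (λ v → ¬? (v ∈? xs)) (fv formula)

    IsSolved : Set
    IsSolved =
      Unique (xs ++ zs) ×
      (∀ x s → x ∈ xs → s ∈ ss → x ∉ tvars s) ×
      (∀ z → z ∈ zs → z ∈ fv matrix) ×
      (∀ z s → z ∈ zs → s ∈ ss → ¬ (s ≡ var z))

    lookupEq : List (Var × Term) → Var → Term
    lookupEq [] v = var v
    lookupEq ((x , s) ∷ ps) v = if v ≡ᵇ x then s else lookupEq ps v

    substOf : Subst
    substOf = mkSubst (xs ++ params) (lookupEq allEqs)
  open SolvedData public

  Corresponds : Subst → Formula → Set₁
  Corresponds σ E =
    ((E ≈E tt) × (σ ≈ₛ emptySubst)) ⊎
    Σ SolvedData (λ d → IsSolved d × (E ≈E formula d) × (σ ≈ₛ substOf d))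

{-# OPTIONS --safe #-}
-- For a structure M, let Sol M σ be the set of assignments α that factor through σ, i.e. for some
-- assignment β, α x is the value of σ(x) under β for each x in Dom(σ).  Regular extensions do not
-- change Sol, so σ ⪯ θ implies Sol M σ ⊆ Sol M θ, and Sol M is an invariant of ≈.  The substitution
-- read off a solved form has the assignments satisfying that solved form as its Sol, so a σ
-- corresponding to E has as its Sol the assignments satisfying E, in every model of FEA.  On the
-- other hand the substitution lemma shows that F σ is valid in M iff F holds on Sol M σ.
module Submission where

open import Defs
open import Function.Bundles using (_⇔_; mk⇔; Equivalence)
open import Function.Base using (_∘_; id)
open import Function.Construct.Identity using (⇔-id)
open import Function.Construct.Composition using (_⇔-∘_)
open import Function.Related.TypeIsomorphisms using (→-cong-⇔; ¬-cong-⇔)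
open import Data.Bool using (true; false; if_then_else_)
open import Data.Empty using (⊥-elim)
open import Data.Fin using (Fin; toℕ)
open import Data.Fin.Properties using (pigeonhole; toℕ<n)
open import Data.List using (List; []; _∷_; _++_; filter; length; map; lookup)
open import Data.List.Membership.DecPropositional using () renaming (_∈?_ to member?)
open import Data.List.Membership.Propositional using (_∈_; _∉_; find; lose)
open import Data.List.Membership.Propositional.Properties
  using (∈-++⁺ˡ; ∈-++⁺ʳ; ∈-++⁻; ∈-concatMap⁺; ∈-filter⁺; ∈-filter⁻; ∈-length; ∈-map⁺; ∈-map⁻)
open import Data.List.Properties using (length-filter)
import Data.List.Relation.Unary.All as All
open import Data.List.Relation.Unary.All.Properties using (++⁻ˡ)
open import Data.List.Relation.Unary.Any using (Any; here; there; any?; index)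
open import Data.List.Relation.Unary.Any.Properties using (lookup-index)
open import Data.List.Relation.Unary.AllPairs using ([]; _∷_)
open import Data.List.Relation.Unary.Unique.Propositional using (Unique)
open import Data.Nat using (ℕ; zero; suc; _+_; _≡ᵇ_; _≤_; _<_; z≤n; s≤s; s≤s⁻¹)
open import Data.Nat.Properties
  using (_≟_; ≤-refl; ≤-trans; <⇒≢; n≮0; n≤0⇒n≡0; m≤n⇒m<n∨m≡n; m≤n⇒m≤1+n; m<n⇒m<1+n; m+n≤o⇒m≤o;
         m+n≤o⇒n≤o; +-suc; +-identityʳ; ⊓-sel)
open import Data.Product using (Σ; _×_; _,_; proj₁; proj₂)
open import Data.Product.Function.NonDependent.Propositional using (_×-⇔_)
open import Data.Sum using (_⊎_; inj₁; inj₂; [_,_]′)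
open import Data.Sum.Function.Propositional using (_⊎-⇔_)
open import Data.Unit using (tt)
open import Data.Vec using (Vec; []; _∷_)
open import Relation.Binary.PropositionalEquality
  using (_≡_; _≢_; refl; sym; trans; cong; cong₂; subst; ≢-sym)
open import Relation.Nullary using (¬_; Dec; yes; no; does; ¬?)
open import Relation.Nullary.Decidable using (dec-true; dec-false; map′)

open Equivalence using (to; from)

-- Lists of variables: fresh names, minima and counting.

_∈?_ : (v : Var) (X : List Var) → Dec (v ∈ X)
_∈?_ = member? _≟_

≡ᵇ-true : ∀ {v x} → v ≡ x → (v ≡ᵇ x) ≡ true
≡ᵇ-true {v} {x} = dec-true (v ≟ x)

≡ᵇ-false : ∀ {v x} → v ≢ x → (v ≡ᵇ x) ≡ false
≡ᵇ-false {v} {x} = dec-false (v ≟ x)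

Σ-cong-⇔ : {A : Set} {P Q : A → Set} → (∀ a → P a ⇔ Q a) → Σ A P ⇔ Σ A Q
Σ-cong-⇔ e = mk⇔ (λ (a , p) → a , to (e a) p) (λ (a , q) → a , from (e a) q)

Π-cong-⇔ : {A : Set} {P Q : A → Set} → (∀ a → P a ⇔ Q a) → (∀ a → P a) ⇔ (∀ a → Q a)
Π-cong-⇔ e = mk⇔ (λ f a → to (e a) (f a)) (λ f a → from (e a) (f a))

iff-cong-⇔ : {A B C D : Set} → A ⇔ C → B ⇔ D →
  ((A → B) × (B → A)) ⇔ ((C → D) × (D → C))
iff-cong-⇔ e f = →-cong-⇔ e f ×-⇔ →-cong-⇔ f e

-- Pigeonhole: sending each of the `suc (length l)` numbers to a position holding it puts two
-- distinct numbers at the same position, whose single entry would equal both.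
initialSegment⊈ : ∀ l → ¬ (∀ j → j ≤ length l → j ∈ l)
initialSegment⊈ l below
  with pigeonhole ≤-refl (λ (i : Fin (suc (length l))) → index (below (toℕ i) (s≤s⁻¹ (toℕ<n i))))
... | i , j , i<j , same = <⇒≢ i<j
  (trans (lookup-index (below (toℕ i) _)) (trans (cong (lookup l) same) (sym (lookup-index (below (toℕ j) _)))))

-- The search loop inside fresh is a local function that cannot be named; unification in fresh≡search
-- solves the underscore to it.
mutual
  search : List Var → ℕ → ℕ → ℕ
  search = _

  fresh≡search : ∀ l → fresh l ≡ search l (length l) 0
  fresh≡search l with length l
  ... | n with 0
  ...   | k = refl

-- The invariant says that every candidate below `k` was rejected and that `n` is the number of
-- trials left before `k` reaches `length l`. If the fuel runs out, a further rejection would put a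
-- whole initial segment of size `suc (length l)` into `l`.
search-∉ : ∀ l n k → n + k ≡ length l → (∀ j → j < k → j ∈ l) → search l n k ∉ l
search-∉ l zero k refl below k∈l =
  initialSegment⊈ l (λ j j≤k → [ below j , (λ { refl → k∈l }) ]′ (m≤n⇒m<n∨m≡n j≤k))
search-∉ l (suc n) k eq below with k ∈? l
... | no k∉l = k∉l
... | yes k∈l = search-∉ l n (suc k) (trans (+-suc n k) eq)
        (λ j j≤k → [ below j , (λ { refl → k∈l }) ]′ (m≤n⇒m<n∨m≡n (s≤s⁻¹ j≤k)))

fresh-∉ : ∀ l → fresh l ∉ l
fresh-∉ l rewrite fresh≡search l = search-∉ l (length l) 0 (+-identityʳ _) (λ _ ())

minList-∈ : ∀ v vs → minList v vs ∈ v ∷ vs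
minList-∈ v [] = here refl
minList-∈ v (w ∷ vs) with ⊓-sel w (minList v vs)
... | inj₁ eq rewrite eq = there (here refl)
... | inj₂ eq rewrite eq with minList-∈ v vs
...   | here p = here p
...   | there p = there (there p)

Unique-++⁻ : {A : Set} (as : List A) {bs : List A} → Unique (as ++ bs) →
  Unique as × (∀ {a} → a ∈ as → a ∉ bs)
Unique-++⁻ [] _ = [] , λ ()
Unique-++⁻ (a ∷ as) (a≢ ∷ unique) with uniqueˡ , disjoint ← Unique-++⁻ as unique =
  ++⁻ˡ as a≢ ∷ uniqueˡ , λ
    { (here refl) a∈bs → All.lookup a≢ (∈-++⁺ʳ as a∈bs) refl
    ; (there i) → disjoint i }

length-filter-mono : {P Q : Var → Set} (P? : ∀ v → Dec (P v)) (Q? : ∀ v → Dec (Q v)) →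
  (∀ {v} → P v → Q v) → ∀ vs → length (filter P? vs) ≤ length (filter Q? vs)
length-filter-mono P? Q? P⊆Q [] = z≤n
length-filter-mono P? Q? P⊆Q (v ∷ vs) with P? v | Q? v
... | yes p | yes q = s≤s (length-filter-mono P? Q? P⊆Q vs)
... | yes p | no ¬q = ⊥-elim (¬q (P⊆Q p))
... | no ¬p | yes q = m≤n⇒m≤1+n (length-filter-mono P? Q? P⊆Q vs)
... | no ¬p | no ¬q = length-filter-mono P? Q? P⊆Q vs

length-filter-strict : {P Q : Var → Set} (P? : ∀ v → Dec (P v)) (Q? : ∀ v → Dec (Q v)) →
  (∀ {v} → P v → Q v) → ∀ {x vs} → x ∈ vs → ¬ P x → Q x →
  length (filter P? vs) < length (filter Q? vs)
length-filter-strict P? Q? P⊆Q {vs = v ∷ vs} x∈vs ¬px qx with P? v | Q? v | x∈vs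
... | yes p | _     | here refl = ⊥-elim (¬px p)
... | no ¬p | no ¬q | here refl = ⊥-elim (¬q qx)
... | no ¬p | yes q | here refl = s≤s (length-filter-mono P? Q? P⊆Q vs)
... | yes p | yes q | there i = s≤s (length-filter-strict P? Q? P⊆Q i ¬px qx)
... | yes p | no ¬q | there i = ⊥-elim (¬q (P⊆Q p))
... | no ¬p | yes q | there i = m<n⇒m<1+n (length-filter-strict P? Q? P⊆Q i ¬px qx)
... | no ¬p | no ¬q | there i = length-filter-strict P? Q? P⊆Q i ¬px qx

-- Free variables and size under renaming.

module _ {L : Lang} where

  ∈-remove⁺ : ∀ {v x X} → v ∈ X → v ≢ x → v ∈ remove L x X
  ∈-remove⁺ {x = x} = ∈-filter⁺ (λ v → ¬? (v ≟ x))

  ∈-remove⁻ : ∀ {v x} X → v ∈ remove L x X → v ∈ X × v ≢ x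
  ∈-remove⁻ {x = x} X = ∈-filter⁻ (λ v → ¬? (v ≟ x)) {xs = X}

  ∈-Range⁺ : ∀ (σ : Subst L) {v w} → v ∈ dom σ → w ∈ tvars L (val σ v) → w ∈ Range L σ
  ∈-Range⁺ σ v∈ w∈ = ∈-concatMap⁺ (λ x → tvars L (val σ x)) (lose v∈ w∈)

  fv⊆allVars : ∀ (F : Formula L) {v} → v ∈ fv L F → v ∈ allVars L F
  fv⊆allVars-++ : ∀ (G H : Formula L) {v} → v ∈ fv L G ++ fv L H → v ∈ allVars L G ++ allVars L H
  fv⊆allVars (atom p ts) = id
  fv⊆allVars (s ≐ t) = id
  fv⊆allVars (¬' G) = fv⊆allVars G
  fv⊆allVars (G ∧' H) = fv⊆allVars-++ G H
  fv⊆allVars (G ∨' H) = fv⊆allVars-++ G H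
  fv⊆allVars (G ⇒' H) = fv⊆allVars-++ G H
  fv⊆allVars (G ⇔' H) = fv⊆allVars-++ G H
  fv⊆allVars (∃' x G) = there ∘ fv⊆allVars G ∘ proj₁ ∘ ∈-remove⁻ (fv L G)
  fv⊆allVars (∀' x G) = there ∘ fv⊆allVars G ∘ proj₁ ∘ ∈-remove⁻ (fv L G)
  fv⊆allVars-++ G H =
    [ ∈-++⁺ˡ ∘ fv⊆allVars G , ∈-++⁺ʳ (allVars L G) ∘ fv⊆allVars H ]′ ∘ ∈-++⁻ (fv L G)

  -- The case `v ≡ y` also records `x ∈ X`, because `applyD` puts the new bound variable into the
  -- domain only when the old one is free in the body.
  Renamed : Var → Var → List Var → Var → Set
  Renamed x y X v = (v ≡ y × x ∈ X) ⊎ (v ∈ X × v ≢ x)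

  Renamed-mono : ∀ {x y X Y v} → (∀ {w} → w ∈ X → w ∈ Y) → Renamed x y X v → Renamed x y Y v
  Renamed-mono X⊆Y (inj₁ (eq , x∈)) = inj₁ (eq , X⊆Y x∈)
  Renamed-mono X⊆Y (inj₂ (v∈ , ne)) = inj₂ (X⊆Y v∈ , ne)

  Renamed-++ : ∀ {x y v} X' {Y'} X {Y} → (v ∈ X' → Renamed x y X v) → (v ∈ Y' → Renamed x y Y v) →
    v ∈ X' ++ Y' → Renamed x y (X ++ Y) v
  Renamed-++ X' X f g =
    [ Renamed-mono ∈-++⁺ˡ ∘ f , Renamed-mono (∈-++⁺ʳ X) ∘ g ]′ ∘ ∈-++⁻ X'

  mutual
    tvars-renT : ∀ x y (t : Term L) {v} → v ∈ tvars L (renT L x y t) → Renamed x y (tvars L t) v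
    tvars-renT x y (var u) v∈ with u ≟ x
    tvars-renT x y (var u) v∈ | yes refl rewrite ≡ᵇ-true {u} refl with here refl ← v∈ = inj₁ (refl , here refl)
    tvars-renT x y (var u) v∈ | no u≢x rewrite ≡ᵇ-false u≢x with here refl ← v∈ = inj₂ (here refl , u≢x)
    tvars-renT x y (fn f ts) = tvars-renT* x y ts

    tvars-renT* : ∀ {n} x y (ts : Vec (Term L) n) {v} →
      v ∈ tvars* L (renT* L x y ts) → Renamed x y (tvars* L ts) v
    tvars-renT* x y (t ∷ ts) =
      Renamed-++ (tvars L (renT L x y t)) (tvars L t) (tvars-renT x y t) (tvars-renT* x y ts)

  Renamed-remove : ∀ {x y z v} X' X → z ≢ x → (v ∈ X' → Renamed x y X v) →
    v ∈ remove L z X' → Renamed x y (remove L z X) v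
  Renamed-remove X' X z≢x f v∈ with ∈-remove⁻ X' v∈
  ... | v∈X' , v≢z with f v∈X'
  ...   | inj₁ (v≡y , x∈X) = inj₁ (v≡y , ∈-remove⁺ x∈X (z≢x ∘ sym))
  ...   | inj₂ (v∈X , v≢x) = inj₂ (∈-remove⁺ v∈X v≢z , v≢x)

  -- Capture of `y` by an inner quantifier can only lose free variables, so the inclusion survives
  -- every clause.
  fv-ren : ∀ x y (F : Formula L) {v} → v ∈ fv L (ren L x y F) → Renamed x y (fv L F) v
  fv-ren-++ : ∀ x y (G H : Formula L) {v} →
    v ∈ fv L (ren L x y G) ++ fv L (ren L x y H) → Renamed x y (fv L G ++ fv L H) v
  fv-ren x y (atom p ts) = tvars-renT* x y ts
  fv-ren x y (s ≐ t) =
    Renamed-++ (tvars L (renT L x y s)) (tvars L s) (tvars-renT x y s) (tvars-renT x y t)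
  fv-ren x y (¬' G) = fv-ren x y G
  fv-ren x y (G ∧' H) = fv-ren-++ x y G H
  fv-ren x y (G ∨' H) = fv-ren-++ x y G H
  fv-ren x y (G ⇒' H) = fv-ren-++ x y G H
  fv-ren x y (G ⇔' H) = fv-ren-++ x y G H
  fv-ren x y (∃' z G) v∈ with z ≟ x
  ... | yes refl rewrite ≡ᵇ-true {z} refl = inj₂ (v∈ , proj₂ (∈-remove⁻ (fv L G) v∈))
  ... | no z≢x rewrite ≡ᵇ-false z≢x =
    Renamed-remove (fv L (ren L x y G)) (fv L G) z≢x (fv-ren x y G) v∈
  fv-ren x y (∀' z G) v∈ with z ≟ x
  ... | yes refl rewrite ≡ᵇ-true {z} refl = inj₂ (v∈ , proj₂ (∈-remove⁻ (fv L G) v∈))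
  ... | no z≢x rewrite ≡ᵇ-false z≢x =
    Renamed-remove (fv L (ren L x y G)) (fv L G) z≢x (fv-ren x y G) v∈
  fv-ren-++ x y G H = Renamed-++ (fv L (ren L x y G)) (fv L G) (fv-ren x y G) (fv-ren x y H)

  size-ren : ∀ x y (F : Formula L) → size L (ren L x y F) ≡ size L F
  size-ren x y tt = refl
  size-ren x y ff = refl
  size-ren x y (atom p ts) = refl
  size-ren x y (s ≐ t) = refl
  size-ren x y (¬' G) = cong suc (size-ren x y G)
  size-ren x y (G ∧' H) = cong suc (cong₂ _+_ (size-ren x y G) (size-ren x y H))
  size-ren x y (G ∨' H) = cong suc (cong₂ _+_ (size-ren x y G) (size-ren x y H))
  size-ren x y (G ⇒' H) = cong suc (cong₂ _+_ (size-ren x y G) (size-ren x y H))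
  size-ren x y (G ⇔' H) = cong suc (cong₂ _+_ (size-ren x y G) (size-ren x y H))
  size-ren x y (∃' z G) with z ≡ᵇ x
  ... | true = refl
  ... | false = cong suc (size-ren x y G)
  size-ren x y (∀' z G) with z ≡ᵇ x
  ... | true = refl
  ... | false = cong suc (size-ren x y G)

  size≢0 : ∀ (F : Formula L) → size L F ≢ 0
  size≢0 tt ()
  size≢0 ff ()
  size≢0 (atom p ts) ()
  size≢0 (s ≐ t) ()
  size≢0 (¬' G) ()
  size≢0 (G ∧' H) ()
  size≢0 (G ∨' H) ()
  size≢0 (G ⇒' H) ()
  size≢0 (G ⇔' H) ()
  size≢0 (∃' x G) ()
  size≢0 (∀' x G) ()

  val-add-≡ : ∀ (σ : Subst L) {v x t} → v ≡ x → val (add L σ x t) v ≡ t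
  val-add-≡ σ eq rewrite ≡ᵇ-true eq = refl

  val-add-≢ : ∀ (σ : Subst L) {v x t} → v ≢ x → val (add L σ x t) v ≡ val σ v
  val-add-≢ σ ne rewrite ≡ᵇ-false ne = refl

  -- `Fsym` comes with no decision procedure for equality, so terms cannot be compared in general;
  -- comparison with a variable is what `Sol-RegExt` asks for.
  isVar? : ∀ (t : Term L) w → Dec (t ≡ var w)
  isVar? (var u) w = map′ (cong var) (λ { refl → refl }) (u ≟ w)
  isVar? (fn f ts) w = no λ ()

-- Semantics: coincidence and renaming.

module _ {L : Lang} (M : Structure L) where

  Assignment : Set
  Assignment = Var → Carrier M

  Agree : List Var → Assignment → Assignment → Set
  Agree X ρ ρ' = ∀ {v} → v ∈ X → ρ v ≡ ρ' v

  -- Outside `dom σ` the values are arbitrary, so later statements compare this assignment with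
  -- others only on lists of variables via `Agree`.
  ⟦_⟧ : Subst L → Assignment → Assignment
  ⟦ σ ⟧ ρ v = evalT L M ρ (val σ v)

  update-≡ : ∀ (ρ : Assignment) x {a} → update L M ρ x a x ≡ a
  update-≡ ρ x rewrite ≡ᵇ-true {x} refl = refl

  update-≢ : ∀ (ρ : Assignment) {x a v} → v ≢ x → update L M ρ x a v ≡ ρ v
  update-≢ ρ ne rewrite ≡ᵇ-false ne = refl

  mutual
    evalT-cong : ∀ t {ρ ρ'} → Agree (tvars L t) ρ ρ' → evalT L M ρ t ≡ evalT L M ρ' t
    evalT-cong (var x) agree = agree (here refl)
    evalT-cong (fn f ts) agree = cong (funI M f) (evalT*-cong ts agree)

    evalT*-cong : ∀ {n} (ts : Vec (Term L) n) {ρ ρ'} →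
      Agree (tvars* L ts) ρ ρ' → evalT* L M ρ ts ≡ evalT* L M ρ' ts
    evalT*-cong [] agree = refl
    evalT*-cong (t ∷ ts) agree =
      cong₂ _∷_ (evalT-cong t (agree ∘ ∈-++⁺ˡ)) (evalT*-cong ts (agree ∘ ∈-++⁺ʳ (tvars L t)))

  update-agree : ∀ {ρ ρ' x} X a → Agree (remove L x X) ρ ρ' →
    Agree X (update L M ρ x a) (update L M ρ' x a)
  update-agree {ρ} {ρ'} {x} X a agree {v} v∈ with v ≟ x
  ... | yes refl = trans (update-≡ ρ x) (sym (update-≡ ρ' x))
  ... | no ne = trans (update-≢ ρ ne) (trans (agree (∈-remove⁺ {L} v∈ ne)) (sym (update-≢ ρ' ne)))

  -- This coincidence lemma stands in for function extensionality: assignments are only ever shown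
  -- equal pointwise, on the variables that matter.
  Sat-cong : ∀ F {ρ ρ'} → Agree (fv L F) ρ ρ' → Sat L M ρ F ⇔ Sat L M ρ' F
  Sat-cong tt agree = ⇔-id _
  Sat-cong ff agree = ⇔-id _
  Sat-cong (atom p ts) agree rewrite evalT*-cong ts agree = ⇔-id _
  Sat-cong (s ≐ t) agree
    rewrite evalT-cong s (agree ∘ ∈-++⁺ˡ) | evalT-cong t (agree ∘ ∈-++⁺ʳ (tvars L s)) = ⇔-id _
  Sat-cong (¬' G) agree = ¬-cong-⇔ (Sat-cong G agree)
  Sat-cong (G ∧' H) agree =
    Sat-cong G (agree ∘ ∈-++⁺ˡ) ×-⇔ Sat-cong H (agree ∘ ∈-++⁺ʳ (fv L G))
  Sat-cong (G ∨' H) agree =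
    Sat-cong G (agree ∘ ∈-++⁺ˡ) ⊎-⇔ Sat-cong H (agree ∘ ∈-++⁺ʳ (fv L G))
  Sat-cong (G ⇒' H) agree =
    →-cong-⇔ (Sat-cong G (agree ∘ ∈-++⁺ˡ)) (Sat-cong H (agree ∘ ∈-++⁺ʳ (fv L G)))
  Sat-cong (G ⇔' H) agree =
    iff-cong-⇔ (Sat-cong G (agree ∘ ∈-++⁺ˡ)) (Sat-cong H (agree ∘ ∈-++⁺ʳ (fv L G)))
  Sat-cong (∃' x G) agree = Σ-cong-⇔ λ a → Sat-cong G (update-agree (fv L G) a agree)
  Sat-cong (∀' x G) agree = Π-cong-⇔ λ a → Sat-cong G (update-agree (fv L G) a agree)

  mutual
    evalT-renT : ∀ x y t {ρ} → evalT L M ρ (renT L x y t) ≡ evalT L M (update L M ρ x (ρ y)) t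
    evalT-renT x y (var v) with v ≡ᵇ x
    ... | true = refl
    ... | false = refl
    evalT-renT x y (fn f ts) = cong (funI M f) (evalT*-renT* x y ts)

    evalT*-renT* : ∀ {n} x y (ts : Vec (Term L) n) {ρ} →
      evalT* L M ρ (renT* L x y ts) ≡ evalT* L M (update L M ρ x (ρ y)) ts
    evalT*-renT* x y [] = refl
    evalT*-renT* x y (t ∷ ts) = cong₂ _∷_ (evalT-renT x y t) (evalT*-renT* x y ts)

  update-absent : ∀ {ρ : Assignment} {x a} X → x ∉ X → Agree X ρ (update L M ρ x a)
  update-absent {ρ} X x∉X v∈X = sym (update-≢ ρ λ { refl → x∉X v∈X })

  update-comm : ∀ (ρ : Assignment) {x y z a} → z ≢ x → z ≢ y → ∀ v →
    update L M (update L M ρ z a) x (update L M ρ z a y) v ≡ update L M (update L M ρ x (ρ y)) z a v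
  update-comm ρ {x} {y} {z} {a} z≢x z≢y v with v ≟ x | v ≟ z
  ... | yes refl | yes refl = ⊥-elim (z≢x refl)
  ... | yes refl | no v≢z = trans (update-≡ (update L M ρ z a) x) (trans (update-≢ ρ (z≢y ∘ sym))
          (sym (trans (update-≢ (update L M ρ x (ρ y)) v≢z) (update-≡ ρ x))))
  ... | no v≢x | yes refl = trans (update-≢ (update L M ρ z a) v≢x) (trans (update-≡ ρ z)
          (sym (update-≡ (update L M ρ x (ρ y)) z)))
  ... | no v≢x | no v≢z = trans (update-≢ (update L M ρ z a) v≢x) (trans (update-≢ ρ v≢z)
          (sym (trans (update-≢ (update L M ρ x (ρ y)) v≢z) (update-≢ ρ v≢x))))

  -- A quantifier over `x` stops the renaming, and there the value of `x` is irrelevant since `x` is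
  -- not free. Under any other quantifier the two updates commute, as the bound variable differs
  -- from `x` and, by freshness, from `y`.
  Sat-ren : ∀ x y F {ρ} → y ∉ allVars L F →
    Sat L M ρ (ren L x y F) ⇔ Sat L M (update L M ρ x (ρ y)) F
  Sat-ren x y tt y∉ = ⇔-id _
  Sat-ren x y ff y∉ = ⇔-id _
  Sat-ren x y (atom p ts) {ρ} y∉ rewrite evalT*-renT* x y ts {ρ} = ⇔-id _
  Sat-ren x y (s ≐ t) {ρ} y∉ rewrite evalT-renT x y s {ρ} | evalT-renT x y t {ρ} = ⇔-id _
  Sat-ren x y (¬' G) y∉ = ¬-cong-⇔ (Sat-ren x y G y∉)
  Sat-ren x y (G ∧' H) y∉ =
    Sat-ren x y G (y∉ ∘ ∈-++⁺ˡ) ×-⇔ Sat-ren x y H (y∉ ∘ ∈-++⁺ʳ (allVars L G))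
  Sat-ren x y (G ∨' H) y∉ =
    Sat-ren x y G (y∉ ∘ ∈-++⁺ˡ) ⊎-⇔ Sat-ren x y H (y∉ ∘ ∈-++⁺ʳ (allVars L G))
  Sat-ren x y (G ⇒' H) y∉ =
    →-cong-⇔ (Sat-ren x y G (y∉ ∘ ∈-++⁺ˡ)) (Sat-ren x y H (y∉ ∘ ∈-++⁺ʳ (allVars L G)))
  Sat-ren x y (G ⇔' H) y∉ =
    iff-cong-⇔ (Sat-ren x y G (y∉ ∘ ∈-++⁺ˡ)) (Sat-ren x y H (y∉ ∘ ∈-++⁺ʳ (allVars L G)))
  Sat-ren x y (∃' z G) {ρ} y∉ with z ≟ x
  ... | yes refl rewrite ≡ᵇ-true {z} refl =
    Sat-cong (∃' z G) (update-absent {ρ} _ λ z∈ → proj₂ (∈-remove⁻ {L} (fv L G) z∈) refl)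
  ... | no z≢x rewrite ≡ᵇ-false z≢x = Σ-cong-⇔ λ a →
    Sat-cong G (λ {v} _ → update-comm ρ z≢x (λ { refl → y∉ (here refl) }) v)
      ⇔-∘ Sat-ren x y G (y∉ ∘ there)
  Sat-ren x y (∀' z G) {ρ} y∉ with z ≟ x
  ... | yes refl rewrite ≡ᵇ-true {z} refl =
    Sat-cong (∀' z G) (update-absent {ρ} _ λ z∈ → proj₂ (∈-remove⁻ {L} (fv L G) z∈) refl)
  ... | no z≢x rewrite ≡ᵇ-false z≢x = Π-cong-⇔ λ a →
    Sat-cong G (λ {v} _ → update-comm ρ z≢x (λ { refl → y∉ (here refl) }) v)
      ⇔-∘ Sat-ren x y G (y∉ ∘ there)

  -- The substitution lemma for terms and formulas.

  mutual
    evalT-subT : ∀ (σ : Subst L) t {ρ} → evalT L M ρ (subT L σ t) ≡ evalT L M (⟦ σ ⟧ ρ) t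
    evalT-subT σ (var x) = refl
    evalT-subT σ (fn f ts) = cong (funI M f) (evalT*-subT* σ ts)

    evalT*-subT* : ∀ {n} (σ : Subst L) (ts : Vec (Term L) n) {ρ} →
      evalT* L M ρ (subT* L σ ts) ≡ evalT* L M (⟦ σ ⟧ ρ) ts
    evalT*-subT* σ [] = refl
    evalT*-subT* σ (t ∷ ts) = cong₂ _∷_ (evalT-subT σ t) (evalT*-subT* σ ts)

  _⊆dom_ : List Var → Subst L → Set
  X ⊆dom σ = ∀ {v} → v ∈ X → v ∈ dom σ

  ⊆dom-restrict : ∀ {σ X} → X ⊆dom σ → X ⊆dom restrict L σ X
  ⊆dom-restrict {X = X} X⊆ v∈ = ∈-filter⁺ (λ v → v ∈? X) (X⊆ v∈) v∈

  -- This is the substitution that `applyD` passes below a quantifier over `x` whose new bound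
  -- variable is `y`; the case without renaming is `y = x`.
  shield : Subst L → List Var → Var → Var → Subst L
  shield σ X x y = if does (x ∈? X) then add L σ y (var y) else σ

  shield-new : ∀ σ {X x} y → x ∈ X → y ∈ dom (shield σ X x y)
  shield-new σ {X} {x} y x∈ rewrite dec-true (x ∈? X) x∈ = here refl

  shield-old : ∀ σ X x y {v} → v ∈ dom σ → v ∈ dom (shield σ X x y)
  shield-old σ X x y v∈ with does (x ∈? X)
  ... | true = there v∈
  ... | false = v∈

  ⟦shield⟧-new : ∀ σ {X x} y {ρ a} → x ∈ X → ⟦ shield σ X x y ⟧ (update L M ρ y a) y ≡ a
  ⟦shield⟧-new σ {X} {x} y {ρ} x∈ rewrite dec-true (x ∈? X) x∈ | val-add-≡ σ {y} {t = var y} refl =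
    update-≡ ρ y

  -- Away from `y` the term assigned to `v` is unchanged, and it does not contain `y`, so it does
  -- not see the update.
  ⟦shield⟧-old : ∀ σ X x {y ρ a v} → y ∉ Range L σ → v ∈ dom σ → v ≢ y →
    ⟦ shield σ X x y ⟧ (update L M ρ y a) v ≡ ⟦ σ ⟧ ρ v
  ⟦shield⟧-old σ X x {y} {ρ} {a} {v} y∉ v∈ v≢y = trans (cong (evalT L M (update L M ρ y a)) val≡)
    (sym (evalT-cong (val σ v) (update-absent {ρ} (tvars L (val σ v)) (y∉ ∘ ∈-Range⁺ σ v∈))))
    where
    val≡ : val (shield σ X x y) v ≡ val σ v
    val≡ with does (x ∈? X)
    ... | true = val-add-≢ σ v≢y
    ... | false = refl

  -- The induction is on the fuel, since a renamed body is not a subformula; `size-ren` keeps the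
  -- fuel bound true. Connectives and the two quantifier cases are delegated to the three companions
  -- below.
  Sat-applyD : ∀ n F σ {ρ} → size L F ≤ n → fv L F ⊆dom σ →
    Sat L M ρ (applyD L n F σ) ⇔ Sat L M (⟦ σ ⟧ ρ) F
  Sat-applyD-restrict : ∀ n F σ {ρ} → size L F ≤ n → fv L F ⊆dom σ →
    Sat L M ρ (applyD L n F (restrict L σ (fv L F))) ⇔ Sat L M (⟦ σ ⟧ ρ) F
  Sat-applyD-bound : ∀ n G σ x {ρ a} → size L G ≤ n → x ∉ Range L σ → remove L x (fv L G) ⊆dom σ →
    Sat L M (update L M ρ x a) (applyD L n G (shield σ (fv L G) x x)) ⇔
    Sat L M (update L M (⟦ σ ⟧ ρ) x a) G
  Sat-applyD-renamed : ∀ n G σ x y {ρ a} → size L G ≤ n → y ∉ Range L σ → y ∉ allVars L G →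
    remove L x (fv L G) ⊆dom σ →
    Sat L M (update L M ρ y a) (applyD L n (ren L x y G) (shield σ (fv L G) x y)) ⇔
    Sat L M (update L M (⟦ σ ⟧ ρ) x a) G

  Sat-applyD zero F σ F≤0 _ = ⊥-elim (size≢0 F (n≤0⇒n≡0 F≤0))
  Sat-applyD (suc n) tt σ _ _ = ⇔-id _
  Sat-applyD (suc n) ff σ _ _ = ⇔-id _
  Sat-applyD (suc n) (atom p ts) σ {ρ} _ _ rewrite evalT*-subT* σ ts {ρ} = ⇔-id _
  Sat-applyD (suc n) (s ≐ t) σ {ρ} _ _ rewrite evalT-subT σ s {ρ} | evalT-subT σ t {ρ} = ⇔-id _
  Sat-applyD (suc n) (¬' G) σ (s≤s le) dom⊇ = ¬-cong-⇔ (Sat-applyD n G σ le dom⊇)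
  Sat-applyD (suc n) (G ∧' H) σ (s≤s le) dom⊇ =
    Sat-applyD-restrict n G σ (m+n≤o⇒m≤o _ le) (dom⊇ ∘ ∈-++⁺ˡ) ×-⇔
    Sat-applyD-restrict n H σ (m+n≤o⇒n≤o _ le) (dom⊇ ∘ ∈-++⁺ʳ (fv L G))
  Sat-applyD (suc n) (G ∨' H) σ (s≤s le) dom⊇ =
    Sat-applyD-restrict n G σ (m+n≤o⇒m≤o _ le) (dom⊇ ∘ ∈-++⁺ˡ) ⊎-⇔
    Sat-applyD-restrict n H σ (m+n≤o⇒n≤o _ le) (dom⊇ ∘ ∈-++⁺ʳ (fv L G))
  Sat-applyD (suc n) (G ⇒' H) σ (s≤s le) dom⊇ = →-cong-⇔
    (Sat-applyD-restrict n G σ (m+n≤o⇒m≤o _ le) (dom⊇ ∘ ∈-++⁺ˡ))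
    (Sat-applyD-restrict n H σ (m+n≤o⇒n≤o _ le) (dom⊇ ∘ ∈-++⁺ʳ (fv L G)))
  Sat-applyD (suc n) (G ⇔' H) σ (s≤s le) dom⊇ = iff-cong-⇔
    (Sat-applyD-restrict n G σ (m+n≤o⇒m≤o _ le) (dom⊇ ∘ ∈-++⁺ˡ))
    (Sat-applyD-restrict n H σ (m+n≤o⇒n≤o _ le) (dom⊇ ∘ ∈-++⁺ʳ (fv L G)))
  Sat-applyD (suc n) (∃' x G) σ (s≤s le) dom⊇ with x ∈? Range L σ
  ... | no x∉ = Σ-cong-⇔ λ a → Sat-applyD-bound n G σ x le x∉ dom⊇
  -- `fresh` avoids the range and all variables of the body at once: the first excludes clashes with
  -- substituted terms, the second capture during renaming.
  ... | yes _ = Σ-cong-⇔ λ a → Sat-applyD-renamed n G σ x _ le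
          (fresh-∉ (Range L σ ++ x ∷ allVars L G) ∘ ∈-++⁺ˡ)
          (fresh-∉ (Range L σ ++ x ∷ allVars L G) ∘ ∈-++⁺ʳ (Range L σ) ∘ there) dom⊇
  Sat-applyD (suc n) (∀' x G) σ (s≤s le) dom⊇ with x ∈? Range L σ
  ... | no x∉ = Π-cong-⇔ λ a → Sat-applyD-bound n G σ x le x∉ dom⊇
  ... | yes _ = Π-cong-⇔ λ a → Sat-applyD-renamed n G σ x _ le
          (fresh-∉ (Range L σ ++ x ∷ allVars L G) ∘ ∈-++⁺ˡ)
          (fresh-∉ (Range L σ ++ x ∷ allVars L G) ∘ ∈-++⁺ʳ (Range L σ) ∘ there) dom⊇

  Sat-applyD-restrict n F σ le dom⊇ =
    Sat-applyD n F (restrict L σ (fv L F)) le (⊆dom-restrict {σ} dom⊇)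

  Sat-applyD-bound n G σ x {ρ} {a} le x∉ dom⊇ = Sat-cong G agree ⇔-∘ Sat-applyD n G σ' le covers
    where
    σ' = shield σ (fv L G) x x

    covers : fv L G ⊆dom σ'
    covers {v} v∈ with v ≟ x
    ... | yes refl = shield-new σ x v∈
    ... | no v≢x = shield-old σ (fv L G) x x (dom⊇ (∈-remove⁺ {L} v∈ v≢x))

    agree : Agree (fv L G) (⟦ σ' ⟧ (update L M ρ x a)) (update L M (⟦ σ ⟧ ρ) x a)
    agree {v} v∈ with v ≟ x
    ... | yes refl = trans (⟦shield⟧-new σ x {ρ} v∈) (sym (update-≡ (⟦ σ ⟧ ρ) x))
    ... | no v≢x = trans (⟦shield⟧-old σ (fv L G) x {ρ = ρ} x∉ (dom⊇ (∈-remove⁺ {L} v∈ v≢x)) v≢x)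
                         (sym (update-≢ (⟦ σ ⟧ ρ) v≢x))

  Sat-applyD-renamed n G σ x y {ρ} {a} le y∉Range y∉G dom⊇ =
    -- Read from right to left: apply the induction hypothesis to the renamed body, undo the
    -- renaming semantically, then compare assignments on the free variables of `G`.
    Sat-cong G agree ⇔-∘ (Sat-ren x y G y∉G ⇔-∘
      Sat-applyD n (ren L x y G) σ' (subst (_≤ n) (sym (size-ren x y G)) le) covers)
    where
    σ' = shield σ (fv L G) x y
    ρ' = ⟦ σ' ⟧ (update L M ρ y a)

    covers : fv L (ren L x y G) ⊆dom σ'
    covers v∈ with fv-ren x y G v∈
    ... | inj₁ (refl , x∈) = shield-new σ y x∈
    ... | inj₂ (v∈G , v≢x) = shield-old σ (fv L G) x y (dom⊇ (∈-remove⁺ {L} v∈G v≢x))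

    agree : Agree (fv L G) (update L M ρ' x (ρ' y)) (update L M (⟦ σ ⟧ ρ) x a)
    agree {v} v∈ with v ≟ x
    ... | yes refl = trans (update-≡ ρ' x)
            (trans (⟦shield⟧-new σ y {ρ} v∈) (sym (update-≡ (⟦ σ ⟧ ρ) x)))
    ... | no v≢x = trans (update-≢ ρ' v≢x)
            (trans (⟦shield⟧-old σ (fv L G) x {ρ = ρ} y∉Range (dom⊇ (∈-remove⁺ {L} v∈ v≢x))
                     -- A free variable of `G` cannot be `y`, so the shielding leaves it alone.
                     (λ { refl → y∉G (fv⊆allVars G v∈) }))
                   (sym (update-≢ (⟦ σ ⟧ ρ) v≢x)))

  -- Solution sets and the application of a substitution.

  Sol : Subst L → Assignment → Set
  Sol σ α = Σ Assignment (λ β → Agree (dom σ) α (⟦ σ ⟧ β))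

  -- Since `y` is not in the range, `β` can be changed at `y` to the value `α x` without disturbing
  -- the old equations; conversely, the equation for `x` is dropped.
  Sol-add : ∀ {σ α x y} → x ∉ dom σ → y ∉ Range L σ → Sol σ α ⇔ Sol (add L σ x (var y)) α
  Sol-add {σ} {α} {x} {y} x∉ y∉ = mk⇔ extend forget
    where
    extend : Sol σ α → Sol (add L σ x (var y)) α
    extend (β , α≡β) = update L M β y (α x) , agree
      where
      agree : Agree (x ∷ dom σ) α (⟦ add L σ x (var y) ⟧ (update L M β y (α x)))
      agree (here refl) rewrite val-add-≡ σ {x} {t = var y} refl = sym (update-≡ β y)
      agree {v} (there v∈) rewrite val-add-≢ σ {v} {x} {var y} (λ { refl → x∉ v∈ }) =
        trans (α≡β v∈) (evalT-cong (val σ v) (update-absent {β} _ (y∉ ∘ ∈-Range⁺ σ v∈)))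

    forget : Sol (add L σ x (var y)) α → Sol σ α
    forget (β , α≡β) = β , λ {v} v∈ → trans (α≡β (there v∈))
      (cong (evalT L M β) (val-add-≢ σ λ { refl → x∉ v∈ }))

  outside : Subst L → List Var → List Var
  outside σ = filter (λ v → ¬? (v ∈? dom σ))

  extendVar : Subst L → Var → Var
  extendVar σ x = if does (x ∈? Range L σ) then fresh (Range L σ) else x

  extendVar-∉ : ∀ σ x → extendVar σ x ∉ Range L σ
  extendVar-∉ σ x with x ∈? Range L σ
  ... | yes _ = fresh-∉ (Range L σ)
  ... | no x∉ = x∉

  minList-outside : ∀ σ vs {v rest} → outside σ vs ≡ v ∷ rest →
    minList v rest ∈ vs × minList v rest ∉ dom σ
  minList-outside σ vs eq = ∈-filter⁻ (λ v → ¬? (v ∈? dom σ)) (subst (_ ∈_) (sym eq) (minList-∈ _ _))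

  Sol-extendStep : ∀ n vs σ {α} → Sol σ α ⇔ Sol (extendStep L n vs σ) α
  Sol-extendStep zero vs σ = ⇔-id _
  Sol-extendStep (suc n) vs σ with outside σ vs in eq
  ... | [] = ⇔-id _
  ... | v ∷ rest =
    Sol-extendStep n vs _ ⇔-∘ Sol-add (proj₂ (minList-outside σ vs eq)) (extendVar-∉ σ (minList v rest))

  -- The entries of `vs` still missing from the domain, counted with repetition, drop by at least
  -- one per step, so fuel equal to their number is enough.
  extendStep-covers : ∀ n vs σ → length (outside σ vs) ≤ n → vs ⊆dom extendStep L n vs σ
  extendStep-covers zero vs σ le {v} v∈ with v ∈? dom σ
  ... | yes v∈σ = v∈σ
  ... | no v∉σ = ⊥-elim (n≮0 (≤-trans (∈-length (∈-filter⁺ (λ v → ¬? (v ∈? dom σ)) v∈ v∉σ)) le))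
  extendStep-covers (suc n) vs σ le {u} u∈ with outside σ vs in eq
  ... | [] with u ∈? dom σ
  ...   | yes u∈σ = u∈σ
  ...   | no u∉σ with () ← subst (u ∈_) eq (∈-filter⁺ (λ v → ¬? (v ∈? dom σ)) u∈ u∉σ)
  extendStep-covers (suc n) vs σ le u∈ | v ∷ rest =
    extendStep-covers n vs σ' (s≤s⁻¹ (≤-trans fewer (subst (λ l → length l ≤ suc n) (sym eq) le))) u∈
    where
    x = minList v rest
    σ' = add L σ x (var (extendVar σ x))

    fewer : length (outside σ' vs) < length (outside σ vs)
    fewer = length-filter-strict (λ v → ¬? (v ∈? dom σ')) (λ v → ¬? (v ∈? dom σ)) (_∘ there)
      (proj₁ (minList-outside σ vs eq)) (λ x∉ → x∉ (here refl)) (proj₂ (minList-outside σ vs eq))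

  -- A solution of the restriction need not solve `σ`, but it can be repaired off `X`: there the
  -- values are read from `σ` under the same `β`, which makes the lost equations true.
  Sol-restrict : ∀ {σ X α} → Sol (restrict L σ X) α → Σ Assignment (λ α' → Agree X α' α × Sol σ α')
  Sol-restrict {σ} {X} {α} (β , α≡β) = α' , on-X , β , on-dom
    where
    α' : Assignment
    α' v = if does (v ∈? X) then α v else ⟦ σ ⟧ β v

    on-X : Agree X α' α
    on-X {v} v∈ rewrite dec-true (v ∈? X) v∈ = refl

    on-dom : Agree (dom σ) α' (⟦ σ ⟧ β)
    on-dom {v} v∈ with v ∈? X
    ... | yes v∈X = α≡β (∈-filter⁺ (λ v → v ∈? X) v∈ v∈X)
    ... | no _ = refl

  valid-apply : ∀ F σ → (∀ ρ → Sat L M ρ (_·_ L F σ)) ⇔ (∀ α → Sol σ α → Sat L M α F)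
  valid-apply F σ = mk⇔ ⇒ ⇐
    where
    σ' = restrict L σ (fv L F)
    σ'' = extendStep L (length (fv L F)) (fv L F) σ'

    covers : fv L F ⊆dom σ''
    covers = extendStep-covers (length (fv L F)) (fv L F) σ' (length-filter _ (fv L F))

    ⇒ : (∀ ρ → Sat L M ρ (_·_ L F σ)) → ∀ α → Sol σ α → Sat L M α F
    ⇒ valid α (β , α≡β)
      -- The same `β` solves the restriction, whose domain is smaller; the completion then yields
      -- `γ` with `α` equal to `⟦ σ'' ⟧ γ` on the free variables of `F`.
      with γ , α≡γ ← to (Sol-extendStep (length (fv L F)) (fv L F) σ')
                        (β , α≡β ∘ proj₁ ∘ ∈-filter⁻ (λ v → v ∈? fv L F) {xs = dom σ})
      = to (Sat-cong F (sym ∘ α≡γ ∘ covers)) (to (Sat-applyD (size L F) F σ'' ≤-refl covers) (valid γ))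

    ⇐ : (∀ α → Sol σ α → Sat L M α F) → ∀ ρ → Sat L M ρ (_·_ L F σ)
    ⇐ valid ρ
      -- The assignment pulled back is `⟦ σ'' ⟧ ρ`, which solves `σ''` with `ρ` itself as parameter;
      -- its repair `α` differs from it only off the free variables of `F`.
      with α , α≡ρ , sol ← Sol-restrict {σ} {fv L F}
             (from (Sol-extendStep (length (fv L F)) (fv L F) σ') (ρ , λ _ → refl))
      = from (Sat-applyD (size L F) F σ'' ≤-refl covers) (to (Sat-cong F α≡ρ) (valid α sol))

  -- Invariance of solution sets under the instantiation preorder.

  -- Each new domain variable `v` is sent to a variable `w`, and `β'` gives `w` the value `α v`.
  -- Injectivity makes this consistent; that `w` avoids the range of `σ` keeps the old equations
  -- intact.
  Sol-RegExt : ∀ {θ σ α} → RegExt L θ σ → Sol σ α → Sol θ α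
  Sol-RegExt {θ} {σ} {α} (dom⊆ , val≡ , toVar , injective) (β , α≡β) = β' , agree
    where
    new = filter (λ v → ¬? (v ∈? dom σ)) (dom θ)

    named? : ∀ w → Dec (Any (λ v → val θ v ≡ var w) new)
    named? w = any? (λ v → isVar? (val θ v) w) new

    β' : Assignment
    β' w with named? w
    ... | yes p = α (proj₁ (find p))
    ... | no _ = β w

    new⁻ : ∀ {v} → v ∈ new → v ∈ dom θ × v ∉ dom σ
    new⁻ = ∈-filter⁻ (λ v → ¬? (v ∈? dom σ)) {xs = dom θ}

    β'-new : ∀ {v w} → v ∈ dom θ → v ∉ dom σ → val θ v ≡ var w → α v ≡ β' w
    β'-new {v} {w} v∈ v∉ eq with named? w
    ... | no ¬p = ⊥-elim (¬p (lose (∈-filter⁺ (λ v → ¬? (v ∈? dom σ)) v∈ v∉) eq))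
    -- The search may have found another new variable `u` with the same image; injectivity
    -- identifies it with `v`.
    ... | yes p with u , u∈ , eq' ← find p | u∈θ , u∉σ ← new⁻ (proj₁ (proj₂ (find p))) =
      cong α (injective v u v∈ v∉ u∈θ u∉σ (trans eq (sym eq')))

    β'-old : Agree (Range L σ) β β'
    β'-old {w} w∈ with named? w
    ... | no _ = refl
    ... | yes p with u , u∈ , eq ← find p | u∈θ , u∉σ ← new⁻ (proj₁ (proj₂ (find p)))
      with w' , eq' , w'∉ ← toVar u u∈θ u∉σ with refl ← trans (sym eq) eq' = ⊥-elim (w'∉ w∈)

    agree : Agree (dom θ) α (⟦ θ ⟧ β')
    agree {v} v∈ with v ∈? dom σ
    ... | yes v∈σ rewrite val≡ v v∈σ = trans (α≡β v∈σ) (evalT-cong (val σ v) (β'-old ∘ ∈-Range⁺ σ v∈σ))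
    ... | no v∉σ with w , eq , _ ← toVar v v∈ v∉σ rewrite eq = β'-new v∈ v∉σ eq

  -- Extend the solution to `σ'`, with parameter `β`. As `σ'` is `θ'` followed by `τ`, the
  -- assignment `⟦ τ ⟧ β` is a parameter for `θ'`, and so for the smaller domain of `θ`.
  Sol-⪯ : ∀ {σ θ α} → _⪯_ L σ θ → Sol σ α → Sol θ α
  Sol-⪯ (τ , σ' , θ' , regσ , (dom⊆ , val≡ , _) , (_ , dom⊇) , _ , (_ , σ'≡θ'τ)) sol
    with β , α≡β ← Sol-RegExt regσ sol =
    ⟦ τ ⟧ β , λ {v} v∈ → trans (α≡β (dom⊇ v (dom⊆ v v∈)))
      (trans (cong (evalT L M β) (σ'≡θ'τ v (dom⊇ v (dom⊆ v v∈))))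
        (trans (evalT-subT τ (val θ' v)) (cong (evalT L M (⟦ τ ⟧ β)) (val≡ v v∈))))

  Sol-≈ : ∀ {σ θ α} → _≈ₛ_ L σ θ → Sol σ α ⇔ Sol θ α
  Sol-≈ (σ⪯θ , θ⪯σ) = mk⇔ (Sol-⪯ σ⪯θ) (Sol-⪯ θ⪯σ)

  -- Solved forms and their substitutions.

  AgreeOff : List Var → Assignment → Assignment → Set
  AgreeOff X ρ ρ' = ∀ v → v ∉ X → ρ v ≡ ρ' v

  Sat-exs : ∀ zs φ {ρ} →
    Sat L M ρ (exs L zs φ) ⇔ Σ Assignment (λ ρ' → AgreeOff zs ρ' ρ × Sat L M ρ' φ)
  Sat-exs [] φ {ρ} = mk⇔ (λ p → ρ , (λ _ _ → refl) , p)
    (λ (ρ' , eq , p) → to (Sat-cong φ (λ {v} _ → eq v λ ())) p)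
  Sat-exs (z ∷ zs) φ {ρ} = mk⇔ ⇒ ⇐
    where
    Witness = Σ Assignment (λ ρ' → AgreeOff (z ∷ zs) ρ' ρ × Sat L M ρ' φ)

    ⇒ : Sat L M ρ (exs L (z ∷ zs) φ) → Witness
    ⇒ (a , p) with ρ' , eq , p' ← to (Sat-exs zs φ) p =
      ρ' , (λ v v∉ → trans (eq v (v∉ ∘ there)) (update-≢ ρ (v∉ ∘ here))) , p'

    ⇐ : Witness → Sat L M ρ (exs L (z ∷ zs) φ)
    ⇐ (ρ' , eq , p) = ρ' z , from (Sat-exs zs φ) (ρ' , eq' , p)
      where
      eq' : AgreeOff zs ρ' (update L M ρ z (ρ' z))
      eq' v v∉ with v ≟ z
      ... | yes refl = sym (update-≡ ρ z)
      ... | no v≢z = trans (eq v λ { (here v≡z) → v≢z v≡z ; (there v∈) → v∉ v∈ }) (sym (update-≢ ρ v≢z))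

  eqn : Var × Term L → Formula L
  eqn (x , s) = var x ≐ s

  Sat-conjF : ∀ ps {ρ} → Sat L M ρ (conjF L (map eqn ps)) ⇔ (∀ p → p ∈ ps → Sat L M ρ (eqn p))
  Sat-conjF [] = mk⇔ (λ _ _ ()) (λ _ → tt)
  Sat-conjF (p ∷ []) = mk⇔ (λ { s _ (here refl) → s }) (λ f → f p (here refl))
  Sat-conjF (p ∷ q ∷ ps) with ih ← Sat-conjF (q ∷ ps) = mk⇔
    (λ { (s , _) _ (here refl) → s ; (_ , s) r (there i) → to ih s r i })
    (λ f → f p (here refl) , from ih (λ r i → f r (there i)))

module _ {L : Lang} where

  fv-exs⁺ : ∀ zs (φ : Formula L) {v} → v ∈ fv L φ → v ∉ zs → v ∈ fv L (exs L zs φ)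
  fv-exs⁺ [] φ v∈ v∉ = v∈
  fv-exs⁺ (z ∷ zs) φ v∈ v∉ = ∈-remove⁺ {L} (fv-exs⁺ zs φ v∈ (v∉ ∘ there)) (v∉ ∘ here)

  fv-exs⁻ : ∀ zs (φ : Formula L) {v} → v ∈ fv L (exs L zs φ) → v ∉ zs
  fv-exs⁻ (z ∷ zs) φ v∈ (here refl) = proj₂ (∈-remove⁻ {L} (fv L (exs L zs φ)) v∈) refl
  fv-exs⁻ (z ∷ zs) φ v∈ (there v∈zs) =
    fv-exs⁻ zs φ (proj₁ (∈-remove⁻ {L} (fv L (exs L zs φ)) v∈)) v∈zs

  fv-conjF : ∀ {φ : Formula L} φs {v} → φ ∈ φs → v ∈ fv L φ → v ∈ fv L (conjF L φs)
  fv-conjF (φ ∷ []) (here refl) v∈ = v∈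
  fv-conjF (φ ∷ ψ ∷ φs) (here refl) v∈ = ∈-++⁺ˡ v∈
  fv-conjF (φ ∷ ψ ∷ φs) (there i) v∈ = ∈-++⁺ʳ (fv L φ) (fv-conjF (ψ ∷ φs) i v∈)

  -- The lookup returns the first match, so distinctness of the left-hand variables is what makes
  -- every equation retrievable.
  lookupEq-∈ : ∀ (d : SolvedData L) ps {x s} → Unique (map proj₁ ps) → (x , s) ∈ ps → lookupEq d ps x ≡ s
  lookupEq-∈ d ((x , s) ∷ ps) _ (here refl) rewrite ≡ᵇ-true {x} refl = refl
  lookupEq-∈ d ((y , _) ∷ ps) (y≢ ∷ unique) (there i)
    rewrite ≡ᵇ-false (≢-sym (All.lookup y≢ (∈-map⁺ proj₁ i))) = lookupEq-∈ d ps unique i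

  lookupEq-∉ : ∀ (d : SolvedData L) ps {x} → x ∉ map proj₁ ps → lookupEq d ps x ≡ var x
  lookupEq-∉ d [] x∉ = refl
  lookupEq-∉ d ((y , _) ∷ ps) x∉ rewrite ≡ᵇ-false (x∉ ∘ here) = lookupEq-∉ d ps (x∉ ∘ there)

module _ {L : Lang} (M : Structure L) (d : SolvedData L) (isSolved : IsSolved d) where

  private
    unique : Unique (xs d ++ zs d)
    unique = proj₁ isSolved

    ps = allEqs d

    lookup-eq : ∀ {x s} → (x , s) ∈ ps → lookupEq d ps x ≡ s
    lookup-eq = lookupEq-∈ d ps (proj₁ (Unique-++⁻ (xs d) unique))

    eq-var∉zs : ∀ {x s} → (x , s) ∈ ps → x ∉ zs d
    eq-var∉zs i = proj₂ (Unique-++⁻ (xs d) unique) (∈-map⁺ proj₁ i)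

    ∈-params⁺ : ∀ {v} → v ∈ fv L (formula d) → v ∉ xs d → v ∈ params d
    ∈-params⁺ = ∈-filter⁺ (λ v → ¬? (v ∈? xs d))

    ∈-params⁻ : ∀ {v} → v ∈ params d → v ∈ fv L (formula d) × v ∉ xs d
    ∈-params⁻ = ∈-filter⁻ (λ v → ¬? (v ∈? xs d)) {xs = fv L (formula d)}

    -- An unbound variable of a right-hand side is free in the solved form, and solvedness keeps it
    -- off the left-hand sides; hence the substitution fixes it.
    rhs-var∈params : ∀ {x s w} → (x , s) ∈ ps → w ∈ tvars L s → w ∉ zs d → w ∈ params d × w ∉ xs d
    rhs-var∈params {x} {s} {w} i w∈ w∉zs = ∈-params⁺ (fv-exs⁺ (zs d) (matrix d) w∈matrix w∉zs) w∉xs , w∉xs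
      where
      w∈matrix : w ∈ fv L (matrix d)
      w∈matrix = fv-conjF _ (∈-map⁺ (eqn M) i) (there w∈)

      w∉xs : w ∉ xs d
      w∉xs w∈xs = proj₁ (proj₂ isSolved) w s w∈xs (∈-map⁺ proj₂ i) w∈

  Sol-substOf : ∀ {α} → Sat L M α (formula d) ⇔ Sol M (substOf d) α
  Sol-substOf {α} = mk⇔ ⇒ ⇐ ⇔-∘ Sat-exs M (zs d) (matrix d)
    where
    Witness = Σ (Assignment M) (λ ρ → AgreeOff M (zs d) ρ α × Sat L M ρ (matrix d))

    ⇒ : Witness → Sol M (substOf d) α
    -- The assignment that fixes the bound variables serves as the parameter: neither left-hand
    -- variables nor parameters are bound, so `ρ` and `α` agree on both.
    ⇒ (ρ , ρ≡α , sat) = ρ , agree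
      where
      agree : Agree M (xs d ++ params d) α (⟦_⟧ M (substOf d) ρ)
      agree v∈ with ∈-++⁻ (xs d) v∈
      ... | inj₁ v∈xs with (x , s) , i , refl ← ∈-map⁻ proj₁ v∈xs rewrite lookup-eq i =
        trans (sym (ρ≡α _ (eq-var∉zs i))) (to (Sat-conjF M ps) sat _ i)
      ... | inj₂ v∈params with v∈fv , v∉xs ← ∈-params⁻ v∈params rewrite lookupEq-∉ d ps v∉xs =
        sym (ρ≡α _ (fv-exs⁻ (zs d) (matrix d) v∈fv))

    ⇐ : Sol M (substOf d) α → Witness
    ⇐ (β , α≡β) = ρ , ρ≡α , from (Sat-conjF M ps) λ (x , s) i →
        trans (ρ≡α _ (eq-var∉zs i)) (trans (α≡β (∈-++⁺ˡ (∈-map⁺ proj₁ i)))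
          (trans (cong (evalT L M β) (lookup-eq i)) (sym (evalT-cong M s (ρ≡β i)))))
      where
      ρ : Assignment M
      -- Bound variables take their values from the parameter `β`. On right-hand sides `ρ` agrees
      -- with `β` throughout, the remaining variables there being parameters, on which `α` equals
      -- `β`.
      ρ v = if does (v ∈? zs d) then β v else α v

      ρ≡α : AgreeOff M (zs d) ρ α
      ρ≡α v v∉ rewrite dec-false (v ∈? zs d) v∉ = refl

      ρ≡β : ∀ {x s} → (x , s) ∈ ps → Agree M (tvars L s) ρ β
      ρ≡β i {w} w∈ with w ∈? zs d
      ... | yes _ = refl
      ... | no w∉zs with w∈params , w∉xs ← rhs-var∈params i w∈ w∉zs =
        trans (α≡β (∈-++⁺ʳ (xs d) w∈params)) (cong (evalT L M β) (lookupEq-∉ d ps w∉xs))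

-- Correspondence and the final equivalence.

-- `≈E` passes from `E` to its solved form inside the model, and `≈ₛ` preserves solutions. If `E` is
-- equivalent to `tt`, the empty substitution imposes no equation, so every assignment is a
-- solution.
Sol-Corresponds : ∀ {L} σ E → Corresponds L σ E → (M : Structure L) → IsFEAModel L M →
  ∀ {ρ} → Sat L M ρ E ⇔ Sol M σ ρ
Sol-Corresponds σ E (inj₁ (E≈tt , σ≈∅)) M fea {ρ} =
  mk⇔ (λ _ → from (Sol-≈ M σ≈∅) (ρ , λ ())) (λ _ → proj₂ (E≈tt M fea ρ) tt)
Sol-Corresponds σ E (inj₂ (d , isSolved , E≈d , σ≈d)) M fea {ρ} = mk⇔
  (from (Sol-≈ M σ≈d) ∘ to (Sol-substOf M d isSolved) ∘ proj₁ (E≈d M fea ρ))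
  (proj₂ (E≈d M fea ρ) ∘ from (Sol-substOf M d isSolved) ∘ to (Sol-≈ M σ≈d))

theorem5p23 : Classical → (L : Lang) → (F E : Formula L) → IsE L E →
    (σ : Subst L) → Corresponds L σ E →
    FEA⊨ L (_·_ L F σ) ⇔ FEA⊨ L (E ⇒' F)
theorem5p23 _ L F E _ σ corr = mk⇔
  -- Both directions work inside one fixed model, which also gives the form with universal closures.
  (λ valid M fea ρ → to (valid-apply M F σ) (valid M fea) ρ ∘ to (Sol-Corresponds σ E corr M fea))
  (λ valid M fea → from (valid-apply M F σ) λ α → valid M fea α ∘ from (Sol-Corresponds σ E corr M fea))
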